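{- Let $n\in\mathbb{N}$ and let $\mathcal{L}$ be a finite set of rectangular polyominoes. If $\mathcal{L}$ is $n$-representable, then $\mathcal{L}$ is strongly $n$-Noetherian.
   Context: A polyomino is a region of $\mathbb{R}^2$ made of unit squares joined along coincident edges, considered up to translation; $p_{a\times b}$ is the rectangular polyomino of height $a$ and width $b$. $R_{n\times m}$ denotes the rectangular region of height $n$ (rows numbered $1,\dots,n$) and width $m$. A tiling of $R_{n\times m}$ by a multiset $T$ of polyominoes is a placement of translates of all elements of $T$ in $R_{n\times m}$ covering every point, with no two different elements having two-dimensional overlap; a tiling by elements of $\mathcal{L}$ is a tiling by a multiset with elements drawn from $\mathcal{L}$. A rearrangement of a tiling by $T$ is any tiling of $R_{n\times m}$ by the same multiset $T$. A tiling of $R_{n\times m}$ admits a subtiling if it has a rearrangement which is the side-by-side juxtaposition of a tiling of $R_{n\times m'}$ and a tiling of $R_{n\times m''}$ with $m=m'+m''$, $m',m''\neq 0$. $\beta_n(\mathcal{L})$ is the smallest natural number such that every tiling of $R_{n\times m}$ by elements of $\mathcal{L}$ with $m>\beta_n(\mathcal{L})$ admits a subtiling, and $\infty$ if no such number exists. $\mathcal{L}$ is strongly $n$-Noetherian if $\beta_n(\mathcal{L})<\infty$. Let $I(n)$ be the set of non-empty contiguous intervals of $\{1,\dots,n\}$. $\mathcal{L}$ is $n$-representable if for every $m$ and every finite multiset $\mathcal{P}$ of pairs $(p_{a\times b},\iota)$ with $p_{a\times b}\in\mathcal{L}$ and $\iota\in I(n)$ having exactly $a$ elements, whenever $$\sum_{(p_{a\times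 b},\iota)\in\mathcal{P}}ab=nm\quad\text{and}\quad\sum_{(p_{a\times b},\iota)\in\mathcal{P},\ i\in\iota}b=m\ \text{ for all }1\le i\le n,$$ there is a tiling of $R_{n\times m}$ by the polyominoes of $\mathcal{P}$ in which each $(p_{a\times b},\iota)$ is placed so that it occupies exactly the rows in $\iota$. -}

module Defs where

open import Data.Fin.Base as Fin using (Fin; toℕ)
import Data.Fin.Properties as Fin
open import Data.List.Base using (List; _++_; filter; map; sum)
open import Data.List.Membership.Propositional using (_∈_)
open import Data.List.Relation.Binary.Permutation.Propositional using (_↭_)
open import Data.List.Relation.Binary.Pointwise.Base using (Pointwise)
open import Data.List.Relation.Unary.All using (All)
open import Data.List.Relation.Unary.AllPairs using (AllPairs)
open import Data.List.Relation.Unary.Any using (Any)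
open import Data.Nat.Base using (ℕ; suc; _+_; _*_; _∸_; _≤_; _<_; _>_; NonZero)
open import Data.Product.Base using (∃-syntax; _×_; _,_; proj₁; proj₂)
open import Function.Base using (_∘_)
open import Function.Bundles using (_⇔_)
open import Relation.Binary.PropositionalEquality.Core using (_≡_)
open import Relation.Nullary.Decidable.Core using (Dec; _×-dec_)
open import Relation.Nullary.Negation.Core using (¬_)

-- Rows and columns are numbered from 0.  The cell (i , j) is the unit square in
-- row i and column j, and R_{n×m} consists of the cells with i < n and j < m.
-- Finite sets and finite multisets are represented by lists: sets are only used
-- through _∈_, and multisets are compared by _↭_.

record Rect : Set where
  constructor rect
  field
    height width  : ℕ
    .{{height≢0}} : NonZero height
    .{{width≢0}}  : NonZero width

open Rect public

-- A translate of a rectangular polyomino.  Natural-number offsets lose nothing: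
-- in a tiling of R_{n×m}, the left edge of a rectangle lies on the boundary
-- or on right edges of other rectangles (and similarly for top edges), so by
-- induction all offsets are integers.
record Tile : Set where
  constructor tile
  field
    shape    : Rect
    top left : ℕ

open Tile public

CoversRow : Tile → ℕ → Set
CoversRow t i = top t ≤ i × i < top t + height (shape t)

CoversColumn : Tile → ℕ → Set
CoversColumn t j = left t ≤ j × j < left t + width (shape t)

Covers : Tile → ℕ → ℕ → Set
Covers t i j = CoversRow t i × CoversColumn t j

NoOverlap : Tile → Tile → Set
NoOverlap t u = ∀ i j → ¬ (Covers t i j × Covers u i j)

Within : ℕ → ℕ → Tile → Set
Within n m t = top t + height (shape t) ≤ n × left t + width (shape t) ≤ m

-- The multiset by which ts tiles is map shape ts.
record IsTiling (n m : ℕ) (ts : List Tile) : Set where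
  field
    within    : All (Within n m) ts
    covering  : ∀ i j → i < n → j < m → Any (λ t → Covers t i j) ts
    noOverlap : AllPairs NoOverlap ts

IsTilingBy : List Rect → ℕ → ℕ → List Tile → Set
IsTilingBy L n m ts = IsTiling n m ts × All (λ t → shape t ∈ L) ts

IsRearrangement : ℕ → ℕ → List Tile → List Tile → Set
IsRearrangement n m ts us = IsTiling n m us × map shape us ↭ map shape ts

shiftRight : ℕ → Tile → Tile
shiftRight k (tile r y x) = tile r y (k + x)

record IsJuxtaposition (n m : ℕ) (us : List Tile) : Set where
  field
    m₁ m₂      : ℕ
    .{{m₁≢0}}  : NonZero m₁
    .{{m₂≢0}}  : NonZero m₂
    widths     : m ≡ m₁ + m₂
    us₁ us₂    : List Tile
    tiling₁    : IsTiling n m₁ us₁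
    tiling₂    : IsTiling n m₂ us₂
    sideBySide : us ↭ us₁ ++ map (shiftRight m₁) us₂

AdmitsSubtiling : ℕ → ℕ → List Tile → Set
AdmitsSubtiling n m ts =
  ∃[ us ] IsRearrangement n m ts us × IsJuxtaposition n m us

SubtilingBound : ℕ → List Rect → ℕ → Set
SubtilingBound n L b =
  ∀ m → m > b → ∀ ts → IsTilingBy L n m ts → AdmitsSubtiling n m ts

-- β_n(L) is an extended natural number; "β n L ≡ b" is rendered as a relation
-- for finite b, and the value ∞ is the case in which no b is related to n and L.
Isβ : ℕ → List Rect → ℕ → Set
Isβ n L b = SubtilingBound n L b × (∀ c → SubtilingBound n L c → b ≤ c)

StronglyNoetherian : ℕ → List Rect → Set
StronglyNoetherian n L = ∃[ b ] Isβ n L b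

-- The elements of I(n): the rows from first to last, both included.
record Interval (n : ℕ) : Set where
  constructor interval
  field
    first last  : Fin n
    .first≤last : first Fin.≤ last

open Interval public

size : ∀ {n} → Interval n → ℕ
size ι = suc (toℕ (last ι) ∸ toℕ (first ι))

infix 4 _∈ᴵ_ _∈ᴵ?_

_∈ᴵ_ : ∀ {n} → Fin n → Interval n → Set
i ∈ᴵ ι = first ι Fin.≤ i × i Fin.≤ last ι

_∈ᴵ?_ : ∀ {n} (i : Fin n) (ι : Interval n) → Dec (i ∈ᴵ ι)
i ∈ᴵ? ι = (first ι Fin.≤? i) ×-dec (i Fin.≤? last ι)

Assigned : ∀ {n} → List Rect → Rect × Interval n → Set
Assigned L (r , ι) = r ∈ L × size ι ≡ height r

totalArea : ∀ {n} → List (Rect × Interval n) → ℕ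
totalArea P = sum (map (λ (r , _) → height r * width r) P)

rowWidth : ∀ {n} → Fin n → List (Rect × Interval n) → ℕ
rowWidth i P = sum (map (width ∘ proj₁) (filter (λ (_ , ι) → i ∈ᴵ? ι) P))

PlacedIn : ∀ {n} → Tile → Rect × Interval n → Set
PlacedIn t (r , ι) = shape t ≡ r × (∀ i → CoversRow t (toℕ i) ⇔ i ∈ᴵ ι)

Representable : ℕ → List Rect → Set
Representable n L =
  ∀ m (P : List (Rect × Interval n)) →
  All (Assigned L) P →
  totalArea P ≡ n * m →
  (∀ i → rowWidth i P ≡ m) →
  ∃[ ts ] IsTiling n m ts × Pointwise PlacedIn ts P

{-# OPTIONS --safe #-}
module Submission where

-- Cut a tiling of R_{n×m} at column x.  In row i, the tiles starting left of x
-- have total width x + p_i(x), where the overhang p_i(x) is at most the largest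
-- width W occurring in L.  If m exceeds (W + 1) ^ n, then two cuts x < y < m have
-- the same overhangs in all rows, so the tiles starting in [x , y) have total
-- width y − x in every row, and the remaining tiles m − (y − x).  By
-- representability, both families tile rectangles of height n.
--
-- That a bound exists does not constructively give a least one.  But, again by
-- representability, whether all tilings of R_{n×m} admit a subtiling depends only
-- on finitely many multisets of (shape, rows), so it is decidable for each m.

open import Data.Fin.Base as Fin using (Fin; toℕ; fromℕ<; funToFin; finToFun)
import Data.Fin.Properties as Fin
open import Data.List.Base using (List; []; _∷_; _++_; filter; length; map)
open import Data.List.Extrema.Nat using (max; xs≤max)
import Data.List.Membership.DecPropositional as DecMembership
open import Data.List.Membership.Propositional using (_∈_; find; lose)
open import Data.List.Membership.Propositional.Properties using (∈-∃++; ∈-map⁺; ∈-filter⁺)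
open import Data.List.Properties using (map-++; map-∘; filter-++; filter-accept; filter-reject; filter-some)
open import Data.List.Relation.Binary.Permutation.Propositional
  using (_↭_; prep; ↭-refl; ↭-sym; ↭-trans; ↭-reflexive; module PermutationReasoning)
open import Data.List.Relation.Binary.Permutation.Propositional.Properties
  using (¬x∷xs↭[]; drop-mid; shift; shifts; ∈-resp-↭; All-resp-↭; filter-↭)
  renaming (map⁺ to ↭-map⁺; ++⁺ʳ to ↭-++⁺ʳ; ++-assoc to ↭-++-assoc)
open import Data.List.Relation.Binary.Pointwise.Base as Pointwise using (Pointwise; []; _∷_)
open import Data.List.Relation.Unary.All as All using (All; []; _∷_)
import Data.List.Relation.Unary.All.Properties as All
open import Data.List.Relation.Unary.AllPairs as AllPairs using (AllPairs; []; _∷_)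
import Data.List.Relation.Unary.AllPairs.Properties as AllPairs
open import Data.List.Relation.Unary.Any as Any using (Any; here; any?)
import Data.List.Relation.Unary.Any.Properties as Any
open import Data.Nat.Base
  using (ℕ; zero; suc; _+_; _*_; _∸_; _^_; _⊓_; _≤_; _<_; _>_; z≤n; s≤s; s≤s⁻¹;
         >-nonZero; >-nonZero⁻¹)
open import Data.Nat.ListAction using (sum)
open import Data.Nat.ListAction.Properties using (sum-++; sum-↭)
open import Data.Nat.Properties
open import Data.Nat.Solver using (module +-*-Solver)
open import Data.Product.Base using (Σ-syntax; ∃-syntax; ∃; _×_; _,_; proj₁; proj₂)
open import Data.Sum.Base using (inj₁; inj₂; [_,_]′)
open import Function.Base using (_∘_; const)
open import Function.Bundles using (_⇔_; mk⇔; module Equivalence)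
open import Relation.Binary.Definitions using (DecidableEquality)
open import Relation.Binary.PropositionalEquality
  using (_≡_; refl; sym; trans; cong; cong₂; subst; subst₂; module ≡-Reasoning)
open import Relation.Nullary.Decidable using (Dec; yes; no; map′; _×-dec_; _⊎-dec_; ¬?; decidable-stable; recompute)
open import Relation.Nullary.Negation using (¬_; contradiction)
open import Relation.Unary using (Decidable)
open import Relation.Unary.Properties using (∁?)
open import Defs

-- Sums over lists

total : {A : Set} → (A → ℕ) → List A → ℕ
total f xs = sum (map f xs)

total-↭ : {A : Set} (f : A → ℕ) {xs ys : List A} → xs ↭ ys → total f xs ≡ total f ys
total-↭ f = sum-↭ ∘ ↭-map⁺ f

total-++ : {A : Set} (f : A → ℕ) (xs ys : List A) → total f (xs ++ ys) ≡ total f xs + total f ys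
total-++ f xs ys = trans (cong sum (map-++ f xs ys)) (sum-++ (map f xs) (map f ys))

total-cong : {A : Set} {f g : A → ℕ} {xs : List A} → All (λ x → f x ≡ g x) xs → total f xs ≡ total g xs
total-cong []         = refl
total-cong (eq ∷ eqs) = cong₂ _+_ eq (total-cong eqs)

total-≤-filter : {A : Set} {P : A → Set} (P? : Decidable P) {f g : A → ℕ} →
                 (∀ x → P x → f x ≤ g x) → (∀ x → ¬ P x → f x ≡ 0) →
                 ∀ xs → total f xs ≤ total g (filter P? xs)
total-≤-filter P? f≤g f≡0 []       = z≤n
total-≤-filter P? {f} f≤g f≡0 (x ∷ xs) with P? x
... | yes p = +-mono-≤ (f≤g x p) (total-≤-filter P? f≤g f≡0 xs)
... | no ¬p = ≤-trans (≤-reflexive (cong (_+ total f xs) (f≡0 x ¬p))) (total-≤-filter P? f≤g f≡0 xs)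

total-filter-≤ : {A : Set} {P : A → Set} (P? : Decidable P) {f g : A → ℕ} {xs : List A} →
                 All (λ x → P x → f x ≤ g x) xs → total f (filter P? xs) ≤ total g xs
total-filter-≤ P? []                  = z≤n
total-filter-≤ P? {xs = x ∷ xs} (le ∷ les) with P? x
... | yes p = +-mono-≤ (le p) (total-filter-≤ P? les)
... | no  _ = ≤-trans (total-filter-≤ P? les) (m≤n+m _ _)

total-1 : {A : Set} (xs : List A) → total (const 1) xs ≡ length xs
total-1 []       = refl
total-1 (x ∷ xs) = cong suc (total-1 xs)

total-filter-pointwise : {A B : Set} {P : A → Set} {Q : B → Set} (P? : Decidable P) (Q? : Decidable Q)
                         {f : A → ℕ} {g : B → ℕ} {xs : List A} {ys : List B} →
                         Pointwise (λ x y → f x ≡ g y × (P x ⇔ Q y)) xs ys →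
                         total f (filter P? xs) ≡ total g (filter Q? ys)
total-filter-pointwise P? Q? [] = refl
total-filter-pointwise P? Q? {xs = x ∷ _} {ys = y ∷ _} ((eq , P⇔Q) ∷ rest) with P? x | Q? y
... | yes _ | yes _ = cong₂ _+_ eq (total-filter-pointwise P? Q? rest)
... | yes p | no ¬q = contradiction (Equivalence.to P⇔Q p) ¬q
... | no ¬p | yes q = contradiction (Equivalence.from P⇔Q q) ¬p
... | no _  | no _  = total-filter-pointwise P? Q? rest

filter-comm : {A : Set} {P Q : A → Set} (P? : Decidable P) (Q? : Decidable Q) (xs : List A) →
              filter P? (filter Q? xs) ≡ filter Q? (filter P? xs)
filter-comm P? Q? []       = refl
filter-comm P? Q? (x ∷ xs) with P? x | Q? x
... | no ¬p | no ¬q = filter-comm P? Q? xs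
... | no ¬p | yes q = trans (filter-reject P? ¬p) (filter-comm P? Q? xs)
... | yes p | no ¬q = trans (filter-comm P? Q? xs) (sym (filter-reject Q? ¬q))
... | yes p | yes q =
  trans (filter-accept P? p) (trans (cong (x ∷_) (filter-comm P? Q? xs)) (sym (filter-accept Q? q)))

filter-⊆ : {A : Set} {P Q : A → Set} (P? : Decidable P) (Q? : Decidable Q) →
           (∀ {x} → P x → Q x) → (xs : List A) → filter P? (filter Q? xs) ≡ filter P? xs
filter-⊆ P? Q? P⊆Q []       = refl
filter-⊆ P? Q? P⊆Q (x ∷ xs) with Q? x
... | yes q with P? x
...   | yes _ = cong (x ∷_) (filter-⊆ P? Q? P⊆Q xs)
...   | no  _ = filter-⊆ P? Q? P⊆Q xs
filter-⊆ P? Q? P⊆Q (x ∷ xs) | no ¬q = trans (filter-⊆ P? Q? P⊆Q xs) (sym (filter-reject P? (¬q ∘ P⊆Q)))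

filter-∁-↭ : {A : Set} {P : A → Set} (P? : Decidable P) (xs : List A) →
             filter P? xs ++ filter (∁? P?) xs ↭ xs
filter-∁-↭ P? []       = ↭-refl
filter-∁-↭ P? (x ∷ xs) with P? x
... | yes _ = prep x (filter-∁-↭ P? xs)
... | no  _ = ↭-trans (shift x (filter P? xs) _) (prep x (filter-∁-↭ P? xs))

-- Sweeping a line over a weighted family of segments [a , a + l)

-- Length of the part of `[a , a + l)` to the left of `x`; truncated subtraction makes it 0 when
-- `x ≤ a`.
covered : ℕ → ℕ → ℕ → ℕ
covered a l x = l ⊓ (x ∸ a)

covered-hit : ∀ {a l x} → a ≤ x → x < a + l → covered a l (suc x) ≡ suc (covered a l x)
covered-hit {a} {l} {x} a≤x x<a+l = begin
  l ⊓ (suc x ∸ a)    ≡⟨ cong (l ⊓_) (+-∸-assoc 1 a≤x) ⟩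
  l ⊓ suc (x ∸ a)    ≡⟨ m≥n⇒m⊓n≡n x∸a<l ⟩
  suc (x ∸ a)        ≡⟨ cong suc (m≥n⇒m⊓n≡n (<⇒≤ x∸a<l)) ⟨
  suc (l ⊓ (x ∸ a))  ∎
  where
  open ≡-Reasoning
  x∸a<l : x ∸ a < l
  x∸a<l = ≤-trans (≤-reflexive (sym (+-∸-assoc 1 a≤x))) (m≤n+o⇒m∸n≤o (suc x) a x<a+l)

covered-before : ∀ {a l x} → x ≤ a → covered a l x ≡ 0
covered-before {a} {l} x≤a = trans (cong (l ⊓_) (m≤n⇒m∸n≡0 x≤a)) (⊓-zeroʳ l)

covered-after : ∀ {a l x} → a + l ≤ x → covered a l x ≡ l
covered-after {a} {l} {x} a+l≤x = m≤n⇒m⊓n≡m (subst (_≤ x ∸ a) (m+n∸m≡n a l) (∸-monoˡ-≤ a a+l≤x))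

covered-miss : ∀ {a l x} → ¬ (a ≤ x × x < a + l) → covered a l (suc x) ≡ covered a l x
covered-miss {a} {l} {x} miss with a ≤? x | x <? a + l
... | yes a≤x | yes x<a+l = contradiction (a≤x , x<a+l) miss
... | yes a≤x | no  x≮a+l =
  trans (covered-after {a} (m≤n⇒m≤1+n (≮⇒≥ x≮a+l))) (sym (covered-after {a} (≮⇒≥ x≮a+l)))
... | no  a≰x | _         =
  trans (covered-before {a} {l} (≰⇒> a≰x)) (sym (covered-before {a} {l} (<⇒≤ (≰⇒> a≰x))))

-- Double counting, one position at a time: the weighted lengths of the segments left of the line
-- equal the weights met at each position passed. It serves twice: across the columns of one row,
-- with every tile of weight 1, and down the rows, with every rectangle weighted by its width.
module Sweep {A : Set} (weight start len : A → ℕ) where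

  swept : ℕ → List A → ℕ
  swept x = total (λ e → weight e * covered (start e) (len e) x)

  swept-zero : ∀ es → swept 0 es ≡ 0
  swept-zero []       = refl
  swept-zero (e ∷ es) = cong₂ _+_
    (trans (cong (weight e *_) (covered-before {start e} {len e} z≤n)) (*-zeroʳ (weight e)))
    (swept-zero es)

  swept-end : ∀ {x es} → All (λ e → start e + len e ≤ x) es → swept x es ≡ total (λ e → weight e * len e) es
  swept-end = total-cong ∘ All.map (λ {e} → cong (weight e *_) ∘ covered-after {start e})

  -- Moving the line from `x` to `suc x` adds 1 to the covered length of exactly the segments
  -- containing `x`. The predicate `Q` is left to the caller, so that the filter is literally the
  -- one in `rowWidth` or `cellTiles`.
  swept-suc : ∀ {Q : A → Set} (Q? : Decidable Q) x →
              (∀ e → Q e ⇔ (start e ≤ x × x < start e + len e)) →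
              ∀ es → swept (suc x) es ≡ swept x es + total weight (filter Q? es)
  swept-suc Q? x hits []       = refl
  swept-suc Q? x hits (e ∷ es) with Q? e
  ... | yes q = begin
    weight e * covered (start e) (len e) (suc x) + swept (suc x) es
      ≡⟨ cong₂ (λ o s → weight e * o + s)
           (covered-hit (proj₁ (to q)) (proj₂ (to q))) (swept-suc Q? x hits es) ⟩
    weight e * suc (covered (start e) (len e) x) + (swept x es + total weight (filter Q? es))
      ≡⟨ solve 4 (λ w o s t → w :* (con 1 :+ o) :+ (s :+ t) := w :* o :+ s :+ (w :+ t)) refl
           (weight e) (covered (start e) (len e) x) (swept x es) (total weight (filter Q? es)) ⟩
    weight e * covered (start e) (len e) x + swept x es + (weight e + total weight (filter Q? es)) ∎
    where
    open ≡-Reasoning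
    open +-*-Solver
    open Equivalence (hits e)
  ... | no ¬q = begin
    weight e * covered (start e) (len e) (suc x) + swept (suc x) es
      ≡⟨ cong₂ (λ o s → weight e * o + s)
           (covered-miss {start e} (¬q ∘ Equivalence.from (hits e))) (swept-suc Q? x hits es) ⟩
    weight e * covered (start e) (len e) x + (swept x es + total weight (filter Q? es))
      ≡⟨ +-assoc (weight e * _) _ _ ⟨
    weight e * covered (start e) (len e) x + swept x es + total weight (filter Q? es) ∎
    where open ≡-Reasoning

-- Rows of a tiling

coversRow? : ∀ i → Decidable (λ t → CoversRow t i)
coversRow? i t = (top t ≤? i) ×-dec (i <? top t + height (shape t))

coversColumn? : ∀ j → Decidable (λ t → CoversColumn t j)
coversColumn? j t = (left t ≤? j) ×-dec (j <? left t + width (shape t))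

leftOf? : ∀ x → Decidable (λ t → left t < x)
leftOf? x t = left t <? x

tileWidth : Tile → ℕ
tileWidth = width ∘ shape

rowTiles : ℕ → List Tile → List Tile
rowTiles i = filter (coversRow? i)

tileRowWidth : ℕ → List Tile → ℕ
tileRowWidth i ts = total tileWidth (rowTiles i ts)

overlapping-≤1 : ∀ {i j ts} → AllPairs NoOverlap ts → All (λ t → Covers t i j) ts → length ts ≤ 1
overlapping-≤1 []               []            = z≤n
overlapping-≤1 (_ ∷ [])         (_ ∷ [])      = s≤s z≤n
overlapping-≤1 ((d ∷ _) ∷ _ ∷ _) (c ∷ c′ ∷ _) = contradiction (c , c′) (d _ _)

module _ {n m ts} (T : IsTiling n m ts) where

  open IsTiling T
  open Sweep {Tile} (const 1) left tileWidth

  cellTiles : ℕ → ℕ → List Tile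
  cellTiles i j = filter (coversColumn? j) (rowTiles i ts)

  cellTiles-≤1 : ∀ i j → length (cellTiles i j) ≤ 1
  cellTiles-≤1 i j = overlapping-≤1
    (AllPairs.filter⁺ (coversColumn? j) (AllPairs.filter⁺ (coversRow? i) noOverlap))
    (All.zip (All.filter⁺ (coversColumn? j) (All.all-filter (coversRow? i) ts) ,
              All.all-filter (coversColumn? j) (rowTiles i ts)))

  cellTiles-≥1 : ∀ {i j} → i < n → j < m → 1 ≤ length (cellTiles i j)
  cellTiles-≥1 {i} {j} i<n j<m with find (covering i j i<n j<m)
  ... | t , t∈ts , row , col = filter-some (coversColumn? j) (lose (∈-filter⁺ (coversRow? i) t∈ts row) col)

  swept-step : ∀ i x → swept (suc x) (rowTiles i ts) ≡ swept x (rowTiles i ts) + length (cellTiles i x)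
  swept-step i x = trans (swept-suc (coversColumn? x) x (λ _ → mk⇔ (λ h → h) (λ h → h)) (rowTiles i ts))
                         (cong (swept x (rowTiles i ts) +_) (total-1 (cellTiles i x)))

  -- Uses non-overlap alone: at most one tile meets each cell. Hence `x` may exceed `m`, as happens
  -- when `cutWidth-≤` sweeps up to `x + W`.
  swept-≤ : ∀ i x → swept x (rowTiles i ts) ≤ x
  swept-≤ i zero    = ≤-reflexive (swept-zero (rowTiles i ts))
  swept-≤ i (suc x) = begin
    swept (suc x) (rowTiles i ts)                          ≡⟨ swept-step i x ⟩
    swept x (rowTiles i ts) + length (cellTiles i x)       ≤⟨ +-mono-≤ (swept-≤ i x) (cellTiles-≤1 i x) ⟩
    x + 1                                                  ≡⟨ +-comm x 1 ⟩
    suc x                                                  ∎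
    where open ≤-Reasoning

  -- Uses covering: every cell inside the rectangle meets at least one tile.
  swept-≥ : ∀ {i x} → i < n → x ≤ m → x ≤ swept x (rowTiles i ts)
  swept-≥ {i} {zero}  i<n x≤m = z≤n
  swept-≥ {i} {suc x} i<n x<m = begin
    suc x                                                  ≡⟨ +-comm 1 x ⟩
    x + 1                                                  ≤⟨ +-mono-≤ (swept-≥ i<n (<⇒≤ x<m)) (cellTiles-≥1 i<n x<m) ⟩
    swept x (rowTiles i ts) + length (cellTiles i x)       ≡⟨ swept-step i x ⟨
    swept (suc x) (rowTiles i ts)                          ∎
    where open ≤-Reasoning

  tiling-rowWidth : ∀ {i} → i < n → tileRowWidth i ts ≡ m
  tiling-rowWidth {i} i<n = begin
    total tileWidth (rowTiles i ts)
      ≡⟨ total-cong (All.universal (λ t → sym (*-identityˡ (tileWidth t))) (rowTiles i ts)) ⟩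
    total (λ t → 1 * tileWidth t) (rowTiles i ts)          ≡⟨ swept-end (All.filter⁺ (coversRow? i) (All.map proj₂ within)) ⟨
    swept m (rowTiles i ts)                                ≡⟨ ≤-antisym (swept-≤ i m) (swept-≥ i<n ≤-refl) ⟩
    m                                                      ∎
    where open ≡-Reasoning

  -- A tile that crosses the cut counts with its full width, so the excess over `x` is the overhang.
  cutWidth : ℕ → ℕ → ℕ
  cutWidth i x = tileRowWidth i (filter (leftOf? x) ts)

  private
    cutWidth-comm : ∀ i x → cutWidth i x ≡ total tileWidth (filter (leftOf? x) (rowTiles i ts))
    cutWidth-comm i x = cong (total tileWidth) (filter-comm (coversRow? i) (leftOf? x) ts)

  -- The tiles of the row cover all `x` columns left of the cut, and a tile that does not start
  -- there contributes nothing to them.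
  cutWidth-≥ : ∀ {i x} → i < n → x ≤ m → x ≤ cutWidth i x
  cutWidth-≥ {i} {x} i<n x≤m = begin
    x                                                       ≤⟨ swept-≥ i<n x≤m ⟩
    swept x (rowTiles i ts)                                 ≤⟨ total-≤-filter (leftOf? x) inside outside (rowTiles i ts) ⟩
    total tileWidth (filter (leftOf? x) (rowTiles i ts))    ≡⟨ cutWidth-comm i x ⟨
    cutWidth i x                                            ∎
    where
    open ≤-Reasoning
    inside : ∀ t → left t < x → 1 * covered (left t) (tileWidth t) x ≤ tileWidth t
    inside t _ = ≤-trans (≤-reflexive (*-identityˡ _)) (m⊓n≤m (tileWidth t) _)
    outside : ∀ t → ¬ left t < x → 1 * covered (left t) (tileWidth t) x ≡ 0
    outside t t≮x = trans (*-identityˡ _) (covered-before {left t} {tileWidth t} (≮⇒≥ t≮x))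

  -- No tile starting left of x reaches further than x + W.
  cutWidth-≤ : ∀ {W} → All (λ t → tileWidth t ≤ W) ts → ∀ i x → cutWidth i x ≤ x + W
  cutWidth-≤ {W} ts≤W i x = begin
    cutWidth i x                                            ≡⟨ cutWidth-comm i x ⟩
    total tileWidth (filter (leftOf? x) (rowTiles i ts))
      ≤⟨ total-filter-≤ (leftOf? x) (All.map (λ {t} → reach t) (All.filter⁺ (coversRow? i) ts≤W)) ⟩
    swept (x + W) (rowTiles i ts)                           ≤⟨ swept-≤ i (x + W) ⟩
    x + W                                                   ∎
    where
    open ≤-Reasoning
    reach : ∀ t → tileWidth t ≤ W → left t < x → tileWidth t ≤ 1 * covered (left t) (tileWidth t) (x + W)
    reach t t≤W t<x = ≤-reflexive (trans (sym (covered-after {left t} (+-mono-≤ (<⇒≤ t<x) t≤W))) (sym (*-identityˡ _)))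

-- Multisets of shapes with assigned rows

record Fills {n} (L : List Rect) (m : ℕ) (P : List (Rect × Interval n)) : Set where
  constructor fills
  field
    assigned  : All (Assigned L) P
    rowWidths : ∀ i → rowWidth i P ≡ m

shapes : ∀ {n} → List (Rect × Interval n) → List Rect
shapes = map proj₁

rows : ∀ {n} (t : Tile) → top t + height (shape t) ≤ n →
       ∃[ ι ] PlacedIn {n} t (shape t , ι) × size ι ≡ height (shape t)
-- Height zero contradicts the `NonZero` field; height `suc h` from row `y` makes `y + h` the last
-- row.
rows (tile (rect zero w {{()}}) y x) _
rows {n} (tile (rect (suc h) w) y x) bottom≤n =
  interval (fromℕ< y<n) (fromℕ< y+h<n) (subst₂ _≤_ (sym first≡) (sym last≡) (m≤m+n y h)) ,
  (refl , λ i → mk⇔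
    (λ (y≤i , i<) → ≤-trans (≤-reflexive first≡) y≤i ,
                    ≤-trans (s≤s⁻¹ (subst (toℕ i <_) (+-suc y h) i<)) (≤-reflexive (sym last≡)))
    (λ (f≤i , i≤l) → ≤-trans (≤-reflexive (sym first≡)) f≤i ,
                     subst (toℕ i <_) (sym (+-suc y h)) (s≤s (≤-trans i≤l (≤-reflexive last≡))))) ,
  cong suc (trans (cong₂ _∸_ last≡ first≡) (m+n∸m≡n y h))
  where
  y+h<n : y + h < n
  y+h<n = subst (_≤ n) (+-suc y h) bottom≤n
  y<n : y < n
  y<n = ≤-<-trans (m≤m+n y h) y+h<n
  first≡ : toℕ (fromℕ< y<n) ≡ y
  first≡ = Fin.toℕ-fromℕ< y<n
  last≡ : toℕ (fromℕ< y+h<n) ≡ y + h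
  last≡ = Fin.toℕ-fromℕ< y+h<n

placed-shapes : ∀ {n ts} {P : List (Rect × Interval n)} → Pointwise PlacedIn ts P → shapes P ≡ map shape ts
placed-shapes []               = refl
placed-shapes ((eq , _) ∷ pls) = cong₂ _∷_ (sym eq) (placed-shapes pls)

placed-rowWidth : ∀ {n ts} {P : List (Rect × Interval n)} → Pointwise PlacedIn ts P →
                  ∀ i → rowWidth i P ≡ tileRowWidth (toℕ i) ts
placed-rowWidth pls i = sym (total-filter-pointwise (coversRow? (toℕ i)) (λ (_ , ι) → i ∈ᴵ? ι)
  (Pointwise.map (λ (eq , covers) → cong width eq , covers i) pls))

-- Forgets columns and keeps rows. The tiles need not form a tiling, since this is also applied to
-- the two families produced by a pair of cuts.
assign : ∀ {n m L ts} → All (Within n m) ts → All (λ t → shape t ∈ L) ts →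
         Σ[ P ∈ List (Rect × Interval n) ] All (Assigned L) P × Pointwise PlacedIn ts P
assign []        []          = [] , [] , []
assign {ts = t ∷ _} ((bottom≤n , _) ∷ ws) (t∈L ∷ ts∈L) with rows t bottom≤n | assign ws ts∈L
... | ι , placed , size≡ | P , as , pls = (shape t , ι) ∷ P , (t∈L , size≡) ∷ as , placed ∷ pls

tiling⇒fills : ∀ {n m L ts} → IsTilingBy L n m ts →
               Σ[ P ∈ List (Rect × Interval n) ] Fills L m P × shapes P ≡ map shape ts
tiling⇒fills (T , ts∈L) with assign (IsTiling.within T) ts∈L
... | P , as , pls = P , fills as (λ i → trans (placed-rowWidth pls i) (tiling-rowWidth T (Fin.toℕ<n i))) , placed-shapes pls

-- A rectangle of width `b` adds `b` to each row of its interval, so sweeping down the rows adds `m`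
-- per row. This supplies the area equation in the premises of `Representable`.
fills-area : ∀ {n m L} {P : List (Rect × Interval n)} → Fills L m P → totalArea P ≡ n * m
fills-area {n} {m} {L} {P} (fills as widths) = begin
  totalArea P                                        ≡⟨ total-cong (All.map (λ {p} → area p) as) ⟩
  total (λ (r , ι) → width r * size ι) P             ≡⟨ swept-end (All.universal (λ (_ , ι) → ends ι) P) ⟨
  swept n P                                          ≡⟨ swept-rows n ≤-refl ⟩
  n * m                                              ∎
  where
  open ≡-Reasoning
  open Sweep {Rect × Interval n} (width ∘ proj₁) (toℕ ∘ first ∘ proj₂) (size ∘ proj₂)

  ordered : (ι : Interval n) → toℕ (first ι) ≤ toℕ (last ι)
  ordered (interval f l f≤l) = recompute (f Fin.≤? l) f≤l

  end : (ι : Interval n) → toℕ (first ι) + size ι ≡ suc (toℕ (last ι))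
  end ι = trans (+-suc _ _) (cong suc (m+[n∸m]≡n (ordered ι)))

  ends : (ι : Interval n) → toℕ (first ι) + size ι ≤ n
  ends ι = ≤-trans (≤-reflexive (end ι)) (Fin.toℕ<n (last ι))

  area : ∀ p → Assigned L p → height (proj₁ p) * width (proj₁ p) ≡ width (proj₁ p) * size (proj₂ p)
  area (r , _) (_ , size≡) = trans (*-comm (height r) (width r)) (cong (width r *_) (sym size≡))

  swept-rows : ∀ k → k ≤ n → swept k P ≡ k * m
  swept-rows zero    _   = swept-zero P
  swept-rows (suc k) k<n = begin
    swept (suc k) P                    ≡⟨ swept-suc (λ (_ , ι) → i ∈ᴵ? ι) k hits P ⟩
    swept k P + rowWidth i P           ≡⟨ cong₂ _+_ (swept-rows k (<⇒≤ k<n)) (widths i) ⟩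
    k * m + m                          ≡⟨ +-comm (k * m) m ⟩
    suc k * m                          ∎
    where
    i : Fin n
    i = fromℕ< k<n
    i≡k : toℕ i ≡ k
    i≡k = Fin.toℕ-fromℕ< k<n
    hits : ∀ ((_ , ι) : Rect × Interval n) → (i ∈ᴵ ι) ⇔ (toℕ (first ι) ≤ k × k < toℕ (first ι) + size ι)
    hits (_ , ι) = mk⇔
      (λ (f≤i , i≤l) → subst (toℕ (first ι) ≤_) i≡k f≤i ,
                       subst₂ _<_ i≡k (sym (end ι)) (s≤s i≤l))
      (λ (f≤k , k<e) → subst (toℕ (first ι) ≤_) (sym i≡k) f≤k ,
                       subst (_≤ toℕ (last ι)) (sym i≡k) (s≤s⁻¹ (subst (k <_) (end ι) k<e)))

length≤totalArea : ∀ {n} (P : List (Rect × Interval n)) → length P ≤ totalArea P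
length≤totalArea []            = z≤n
length≤totalArea ((rect h w , _) ∷ P) = +-mono-≤ (*-mono-≤ (>-nonZero⁻¹ h) (>-nonZero⁻¹ w)) (length≤totalArea P)

-- Every rectangle has area at least 1. This bound makes the later search through such multisets
-- finite.
fills-length : ∀ {n m L} {P : List (Rect × Interval n)} → Fills L m P → length P ≤ n * m
fills-length {P = P} F = ≤-trans (length≤totalArea P) (≤-reflexive (fills-area F))

-- The one place where representability is applied; all later uses go through this lemma.
fills⇒tiling : ∀ {n m L} {P : List (Rect × Interval n)} → Representable n L → Fills L m P →
               ∃[ ts ] IsTilingBy L n m ts × map shape ts ≡ shapes P
fills⇒tiling {m = m} {L} {P} rep F@(fills as widths) with rep m P as (fills-area F) widths
... | ts , T , pls = ts , (T , All.map⁻ (subst (All (_∈ L)) (placed-shapes pls) (All.map⁺ (All.map proj₁ as)))) ,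
                     sym (placed-shapes pls)

-- Juxtaposition

juxtapose : ∀ {n m₁ m₂ ts₁ ts₂} → IsTiling n m₁ ts₁ → IsTiling n m₂ ts₂ →
            IsTiling n (m₁ + m₂) (ts₁ ++ map (shiftRight m₁) ts₂)
juxtapose {n} {m₁} {m₂} {ts₁} {ts₂} T₁ T₂ = record
  { within    = All.++⁺
      (All.map (λ (v , h) → v , ≤-trans h (m≤m+n m₁ m₂)) T₁.within)
      (All.map⁺ (All.map (λ {t} (v , h) → v , ≤-trans (≤-reflexive (+-assoc m₁ (left t) _)) (+-monoʳ-≤ m₁ h)) T₂.within))
  ; covering  = cover
  ; noOverlap = AllPairs.++⁺ T₁.noOverlap
      (AllPairs.map⁺ (AllPairs.map (λ {t} {u} → apart {t} {u}) T₂.noOverlap))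
      (All.map (λ {t} (_ , h) → All.map⁺ (All.universal (separated t h) ts₂)) T₁.within)
  }
  where
  module T₁ = IsTiling T₁
  module T₂ = IsTiling T₂

  shift-covers : ∀ {t i j} → Covers t i j → Covers (shiftRight m₁ t) i (m₁ + j)
  shift-covers {t} (row , l , r) =
    row , +-monoʳ-≤ m₁ l , <-≤-trans (+-monoʳ-< m₁ r) (≤-reflexive (sym (+-assoc m₁ (left t) _)))

  unshift-covers : ∀ {t i j} → Covers (shiftRight m₁ t) i j → Covers t i (j ∸ m₁)
  unshift-covers {t} {i} {j} (row , l , r) =
    row , m+n≤o⇒n≤o∸m l ,
    +-cancelˡ-< m₁ _ _ (subst₂ _<_ (sym (m+[n∸m]≡n (m+n≤o⇒m≤o m₁ l))) (+-assoc m₁ (left t) _) r)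
    where
    m+n≤o⇒n≤o∸m : ∀ {o} → m₁ + left t ≤ o → left t ≤ o ∸ m₁
    m+n≤o⇒n≤o∸m le = m+n≤o⇒m≤o∸n (left t) (≤-trans (≤-reflexive (+-comm (left t) m₁)) le)

  apart : ∀ {t u} → NoOverlap t u → NoOverlap (shiftRight m₁ t) (shiftRight m₁ u)
  apart {t} {u} d i j (ct , cu) = d i (j ∸ m₁) (unshift-covers {t} ct , unshift-covers {u} cu)

  separated : ∀ t → left t + width (shape t) ≤ m₁ → ∀ u → NoOverlap t (shiftRight m₁ u)
  separated t right≤m₁ u i j ((_ , _ , j<right) , (_ , m₁≤ , _)) =
    <-irrefl refl (<-≤-trans j<right (≤-trans right≤m₁ (m+n≤o⇒m≤o m₁ m₁≤)))

  cover : ∀ i j → i < n → j < m₁ + m₂ → Any (λ t → Covers t i j) (ts₁ ++ map (shiftRight m₁) ts₂)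
  cover i j i<n j< with <-≤-connex j m₁
  ... | inj₁ j<m₁ = Any.++⁺ˡ (T₁.covering i j i<n j<m₁)
  ... | inj₂ m₁≤j = Any.++⁺ʳ ts₁ (Any.map⁺ (Any.map
    (λ {t} c → subst (Covers (shiftRight m₁ t) i) (m+[n∸m]≡n m₁≤j) (shift-covers {t} c))
    (T₂.covering i (j ∸ m₁) i<n (+-cancelˡ-< m₁ _ _ (subst (_< m₁ + m₂) (sym (m+[n∸m]≡n m₁≤j)) j<)))))

shapes-shiftRight : ∀ k ts → map shape (map (shiftRight k) ts) ≡ map shape ts
shapes-shiftRight k ts = sym (map-∘ ts)

-- What a subtiling amounts to for multisets. Only the shapes have to agree with those of `P`: a
-- rearrangement may move a rectangle to other rows, so the intervals in `P₁` and `P₂` are free.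
record Splits {n} (L : List Rect) (m : ℕ) (P : List (Rect × Interval n)) : Set where
  constructor splits
  field
    {m₁}       : ℕ
    {P₁ P₂}    : List (Rect × Interval n)
    0<m₁       : 0 < m₁
    m₁<m       : m₁ < m
    fills₁     : Fills L m₁ P₁
    fills₂     : Fills L (m ∸ m₁) P₂
    rearranged : shapes P₁ ++ shapes P₂ ↭ shapes P

splits⇒subtiling : ∀ {n L m ts} {P : List (Rect × Interval n)} → Representable n L →
                   shapes P ≡ map shape ts → Splits L m P → AdmitsSubtiling n m ts
splits⇒subtiling {n} {m = m} {ts} {P} rep P≡ts (splits {m₁} {P₁} {P₂} 0<m₁ m₁<m F₁ F₂ P₁P₂↭P)
  with fills⇒tiling rep F₁ | fills⇒tiling rep F₂
... | us₁ , (T₁ , _) , us₁≡P₁ | us₂ , (T₂ , _) , us₂≡P₂ =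
  us₁ ++ map (shiftRight m₁) us₂ ,
  (subst (λ k → IsTiling n k _) m₁+m₂≡m (juxtapose T₁ T₂) , perm) ,
  record
    { m₁ = m₁ ; m₂ = m ∸ m₁ ; m₁≢0 = >-nonZero 0<m₁ ; m₂≢0 = >-nonZero (m<n⇒0<n∸m m₁<m)
    ; widths = sym m₁+m₂≡m ; us₁ = us₁ ; us₂ = us₂ ; tiling₁ = T₁ ; tiling₂ = T₂ ; sideBySide = ↭-refl }
  where
  m₁+m₂≡m : m₁ + (m ∸ m₁) ≡ m
  m₁+m₂≡m = m+[n∸m]≡n (<⇒≤ m₁<m)

  perm : map shape (us₁ ++ map (shiftRight m₁) us₂) ↭ map shape ts
  perm = begin
    map shape (us₁ ++ map (shiftRight m₁) us₂)            ≡⟨ map-++ shape us₁ _ ⟩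
    map shape us₁ ++ map shape (map (shiftRight m₁) us₂)  ≡⟨ cong₂ _++_ us₁≡P₁ (trans (shapes-shiftRight m₁ us₂) us₂≡P₂) ⟩
    shapes P₁ ++ shapes P₂                                ↭⟨ P₁P₂↭P ⟩
    shapes P                                              ≡⟨ P≡ts ⟩
    map shape ts                                          ∎
    where open PermutationReasoning

subtiling⇒splits : ∀ {n L m ts} {P : List (Rect × Interval n)} → All (λ t → shape t ∈ L) ts →
                   shapes P ≡ map shape ts → AdmitsSubtiling n m ts → Splits L m P
subtiling⇒splits {n} {L} {m} {ts} {P} ts∈L P≡ts (us , (_ , us↭ts) , J) =
  splits (>-nonZero⁻¹ m₁) (subst (m₁ <_) (sym widths) (m<m+n m₁ (>-nonZero⁻¹ m₂)))
         (proj₁ (proj₂ piece₁)) (subst (λ k → Fills L k (proj₁ piece₂)) m₂≡m∸m₁ (proj₁ (proj₂ piece₂)))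
         (↭-trans (↭-reflexive (cong₂ _++_ (proj₂ (proj₂ piece₁)) (proj₂ (proj₂ piece₂)))) perm)
  where
  open IsJuxtaposition J

  perm : map shape us₁ ++ map shape us₂ ↭ shapes P
  perm = begin
    map shape us₁ ++ map shape us₂                        ≡⟨ cong (map shape us₁ ++_) (shapes-shiftRight m₁ us₂) ⟨
    map shape us₁ ++ map shape (map (shiftRight m₁) us₂)  ≡⟨ map-++ shape us₁ _ ⟨
    map shape (us₁ ++ map (shiftRight m₁) us₂)            ↭⟨ ↭-map⁺ shape sideBySide ⟨
    map shape us                                          ↭⟨ us↭ts ⟩
    map shape ts                                          ≡⟨ P≡ts ⟨
    shapes P                                              ∎
    where open PermutationReasoning

  -- A juxtaposition does not mention `L`; its pieces use shapes from `L` because together they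
  -- permute the shapes of `ts`.
  pieces∈L : All (_∈ L) (map shape us₁ ++ map shape us₂)
  pieces∈L = All-resp-↭ (↭-sym perm) (subst (All (_∈ L)) (sym P≡ts) (All.map⁺ ts∈L))

  m₂≡m∸m₁ : m₂ ≡ m ∸ m₁
  m₂≡m∸m₁ = sym (trans (cong (_∸ m₁) widths) (m+n∸m≡n m₁ m₂))

  piece₁ : Σ[ P₁ ∈ List (Rect × Interval n) ] Fills L m₁ P₁ × shapes P₁ ≡ map shape us₁
  piece₁ = tiling⇒fills (tiling₁ , All.map⁻ (All.++⁻ˡ (map shape us₁) pieces∈L))

  piece₂ : Σ[ P₂ ∈ List (Rect × Interval n) ] Fills L m₂ P₂ × shapes P₂ ≡ map shape us₂
  piece₂ = tiling⇒fills (tiling₂ , All.map⁻ (All.++⁻ʳ (map shape us₁) pieces∈L))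

-- Cutting at two columns with the same overhangs

-- The number of overhang vectors: one value from 0 to the largest width for each of the `n` rows.
-- An empty `L` gets largest width 0.
cutBound : ℕ → List Rect → ℕ
cutBound n L = suc (max 0 (map width L)) ^ n

width≤max : ∀ {L r} → r ∈ L → width r ≤ max 0 (map width L)
width≤max {L} r∈L = All.lookup (xs≤max 0 (map width L)) (∈-map⁺ width r∈L)

module _ {n L m ts} (TL : IsTilingBy L n m ts) where

  private
    T = proj₁ TL
    W = max 0 (map width L)

    ts≤W : All (λ t → tileWidth t ≤ W) ts
    ts≤W = All.map width≤max (proj₂ TL)

  overhang : Fin m → Fin n → Fin (suc W)
  overhang x i = fromℕ< (s≤s (m≤n+o⇒m∸n≤o (cutWidth T (toℕ i) (toℕ x)) (toℕ x) (cutWidth-≤ T ts≤W (toℕ i) (toℕ x))))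

  equal-overhangs : m > cutBound n L →
                    ∃[ x ] ∃[ y ] x < y × y < m ×
                    (∀ i → i < n → cutWidth T i x ∸ x ≡ cutWidth T i y ∸ y)
  -- The `m` cuts 0, ..., m - 1 are the pigeons. `funToFin` codes the overhang vector of each as one
  -- of `cutBound n L` numbers, so two cuts share a vector.
  equal-overhangs m>B with Fin.pigeonhole m>B (funToFin ∘ overhang)
  ... | x , y , x<y , eq = toℕ x , toℕ y , x<y , Fin.toℕ<n y , same
    where
    agree : ∀ i → overhang x i ≡ overhang y i
    agree i = trans (sym (Fin.finToFun-funToFin (overhang x) i))
                    (trans (cong (λ c → finToFun c i) eq) (Fin.finToFun-funToFin (overhang y) i))
    same : ∀ i → i < n → cutWidth T i (toℕ x) ∸ toℕ x ≡ cutWidth T i (toℕ y) ∸ toℕ y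
    same i i<n = subst (λ k → cutWidth T k (toℕ x) ∸ toℕ x ≡ cutWidth T k (toℕ y) ∸ toℕ y) (Fin.toℕ-fromℕ< i<n)
                       (Fin.fromℕ<-injective _ _ _ _ (agree (fromℕ< i<n)))

  module _ {x y} (x<y : x < y) (y<m : y < m)
           (same : ∀ i → i < n → cutWidth T i x ∸ x ≡ cutWidth T i y ∸ y) where

    private
      -- `between` holds the tiles starting in `[x , y)` and `outside` all others. Both are obtained
      -- by splitting `before`, so that `filter-∁-↭` reassembles them.
      before between outside : List Tile
      before  = filter (leftOf? y) ts
      between = filter (∁? (leftOf? x)) before
      outside = filter (leftOf? x) before ++ filter (∁? (leftOf? y)) ts

      before-↭ : filter (leftOf? x) ts ++ between ↭ before
      before-↭ = ↭-trans (↭-reflexive (cong (_++ between) (sym (filter-⊆ (leftOf? x) (leftOf? y) (λ l<x → <-trans l<x x<y) ts))))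
                         (filter-∁-↭ (leftOf? x) before)

      all-↭ : between ++ outside ↭ ts
      all-↭ = begin
        between ++ filter (leftOf? x) before ++ filter (∁? (leftOf? y)) ts    ↭⟨ shifts between (filter (leftOf? x) before) ⟩
        filter (leftOf? x) before ++ between ++ filter (∁? (leftOf? y)) ts    ↭⟨ ↭-++-assoc (filter (leftOf? x) before) between _ ⟨
        (filter (leftOf? x) before ++ between) ++ filter (∁? (leftOf? y)) ts  ↭⟨ ↭-++⁺ʳ _ (filter-∁-↭ (leftOf? x) before) ⟩
        before ++ filter (∁? (leftOf? y)) ts                                  ↭⟨ filter-∁-↭ (leftOf? y) ts ⟩
        ts                                                                    ∎
        where open PermutationReasoning

      tileRowWidth-↭ : ∀ i us vs {ws} → us ++ vs ↭ ws → tileRowWidth i us + tileRowWidth i vs ≡ tileRowWidth i ws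
      tileRowWidth-↭ i us vs {ws} p = begin
        tileRowWidth i us + tileRowWidth i vs           ≡⟨ total-++ tileWidth (rowTiles i us) (rowTiles i vs) ⟨
        total tileWidth (rowTiles i us ++ rowTiles i vs) ≡⟨ cong (total tileWidth) (filter-++ (coversRow? i) us vs) ⟨
        tileRowWidth i (us ++ vs)                       ≡⟨ total-↭ tileWidth (filter-↭ (coversRow? i) p) ⟩
        tileRowWidth i ws                               ∎
        where open ≡-Reasoning

      -- With common overhang p the width is (y + p) - (x + p). `cutWidth-≥` ensures that the
      -- truncated subtractions defining the overhangs are exact.
      between-rowWidth : ∀ {i} → i < n → tileRowWidth i between ≡ y ∸ x
      between-rowWidth {i} i<n = +-cancelˡ-≡ (cutWidth T i x) _ _ (begin
        cutWidth T i x + tileRowWidth i between         ≡⟨ tileRowWidth-↭ i (filter (leftOf? x) ts) between before-↭ ⟩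
        cutWidth T i y                                  ≡⟨ m∸n+n≡m (cutWidth-≥ T i<n (<⇒≤ y<m)) ⟨
        cutWidth T i y ∸ y + y                          ≡⟨ cong₂ _+_ (same i i<n) (m+[n∸m]≡n (<⇒≤ x<y)) ⟨
        cutWidth T i x ∸ x + (x + (y ∸ x))              ≡⟨ +-assoc (cutWidth T i x ∸ x) x _ ⟨
        cutWidth T i x ∸ x + x + (y ∸ x)                ≡⟨ cong (_+ (y ∸ x)) (m∸n+n≡m (cutWidth-≥ T i<n (<⇒≤ (<-trans x<y y<m)))) ⟩
        cutWidth T i x + (y ∸ x)                        ∎)
        where open ≡-Reasoning

      outside-rowWidth : ∀ {i} → i < n → tileRowWidth i outside ≡ m ∸ (y ∸ x)
      outside-rowWidth {i} i<n = begin
        tileRowWidth i outside                                    ≡⟨ m+n∸m≡n (tileRowWidth i between) _ ⟨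
        tileRowWidth i between + tileRowWidth i outside ∸ tileRowWidth i between
          ≡⟨ cong₂ _∸_ (trans (tileRowWidth-↭ i between outside all-↭) (tiling-rowWidth T i<n)) (between-rowWidth i<n) ⟩
        m ∸ (y ∸ x)                                               ∎
        where open ≡-Reasoning

      kept : ∀ {Q : Tile → Set} → All Q ts → All Q between × All Q outside
      kept Qts = All.++⁻ between (All-resp-↭ (↭-sym all-↭) Qts)

    equal-overhangs⇒splits : {P : List (Rect × Interval n)} → shapes P ≡ map shape ts → Splits L m P
    equal-overhangs⇒splits {P} P≡ts
      with assign (proj₁ (kept (IsTiling.within T))) (proj₁ (kept (proj₂ TL)))
         | assign (proj₂ (kept (IsTiling.within T))) (proj₂ (kept (proj₂ TL)))
    -- The first piece has width `y ∸ x`, positive since `x < y` and below `m` since `y < m`.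
    ... | P₁ , as₁ , pls₁ | P₂ , as₂ , pls₂ = splits
      (m<n⇒0<n∸m x<y) (≤-<-trans (m∸n≤m y x) y<m)
      (fills as₁ (λ i → trans (placed-rowWidth pls₁ i) (between-rowWidth (Fin.toℕ<n i))))
      (fills as₂ (λ i → trans (placed-rowWidth pls₂ i) (outside-rowWidth (Fin.toℕ<n i))))
      (begin
        shapes P₁ ++ shapes P₂                  ≡⟨ cong₂ _++_ (placed-shapes pls₁) (placed-shapes pls₂) ⟩
        map shape between ++ map shape outside  ≡⟨ map-++ shape between outside ⟨
        map shape (between ++ outside)          ↭⟨ ↭-map⁺ shape all-↭ ⟩
        map shape ts                            ≡⟨ P≡ts ⟨
        shapes P                                ∎)
      where open PermutationReasoning

-- Passing from tilings to multisets

AllSplit : ℕ → List Rect → ℕ → Set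
AllSplit n L m = ∀ (P : List (Rect × Interval n)) → Fills L m P → Splits L m P

-- `P` has no columns to cut at, so it is first realised as a tiling.
wide⇒allSplit : ∀ {n L} → Representable n L → ∀ m → m > cutBound n L → AllSplit n L m
wide⇒allSplit rep m m>B P F =
  let ts , TL , ts≡P = fills⇒tiling rep F
      x , y , x<y , y<m , same = equal-overhangs TL m>B
  in equal-overhangs⇒splits TL x<y y<m same (sym ts≡P)

-- Tilings and filling multisets yield each other with the same shapes. One direction turns the
-- bound found for multisets into one for tilings; the other carries over its minimality.
subtilingBound⇔allSplit : ∀ {n L} → Representable n L → ∀ b →
                          SubtilingBound n L b ⇔ (∀ m → m > b → AllSplit n L m)
subtilingBound⇔allSplit {n} {L} rep b = mk⇔ to from
  where
  to : SubtilingBound n L b → ∀ m → m > b → AllSplit n L m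
  to bound m m>b P F with fills⇒tiling rep F
  ... | ts , TL , ts≡P = subtiling⇒splits (proj₂ TL) (sym ts≡P) (bound m m>b ts TL)
  from : (∀ m → m > b → AllSplit n L m) → SubtilingBound n L b
  from split m m>b ts TL with tiling⇒fills TL
  ... | P , F , P≡ts = splits⇒subtiling rep P≡ts (split m m>b P F)

-- Decidability by bounded search

_≟ᴿ_ : DecidableEquality Rect
rect h w ≟ᴿ rect h′ w′ with h ≟ h′ | w ≟ w′
... | yes refl | yes refl = yes refl
... | no h≢h′  | _        = no (h≢h′ ∘ cong height)
... | yes _    | no w≢w′  = no (w≢w′ ∘ cong width)

module _ {A : Set} (_≟ᴬ_ : DecidableEquality A) where

  open DecMembership _≟ᴬ_ using (_∈?_)

  permutation? : (xs ys : List A) → Dec (xs ↭ ys)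
  permutation? []       []       = yes ↭-refl
  permutation? []       (y ∷ ys) = no (¬x∷xs↭[] ∘ ↭-sym)
  permutation? (x ∷ xs) ys with x ∈? ys
  ... | no  x∉ys = no (λ p → x∉ys (∈-resp-↭ p (here refl)))
  ... | yes x∈ys with ∈-∃++ x∈ys
  -- Whichever occurrence of `x` is removed from `ys`, `drop-mid` shows that the remainders must be
  -- permutations of each other.
  ...   | as , bs , refl = map′ (λ p → ↭-trans (prep x p) (↭-sym (shift x as bs))) (drop-mid [] as)
                                (permutation? xs (as ++ bs))

-- Quantifying over every decidable `R` lets searches nest: the test of an outer search may itself
-- be a search, and no list of candidates is built.
Searchable : {A : Set} → (A → Set) → Set₁
Searchable {A} C = ∀ {R : A → Set} → Decidable R → Dec (∃ λ a → C a × R a)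

boundedLists-searchable : {A : Set} {C : A → Set} → Searchable C → ∀ k →
                          Searchable (λ as → length as ≤ k × All C as)
boundedLists-searchable search zero R? =
  map′ (λ r → [] , (z≤n , []) , r) (λ { ([] , _ , r) → r }) (R? [])
boundedLists-searchable search (suc k) {R} R? = map′
  [ (λ r → [] , (z≤n , []) , r) , (λ (a , c , as , (len , cs) , r) → a ∷ as , (s≤s len , c ∷ cs) , r) ]′
  (λ { ([] , _ , r) → inj₁ r ; (a ∷ as , (s≤s len , c ∷ cs) , r) → inj₂ (a , c , as , (len , cs) , r) })
  (R? [] ⊎-dec search (λ a → boundedLists-searchable search k (λ as → R? (a ∷ as))))

assigned-searchable : ∀ {n} L → Searchable (Assigned {n} L)
assigned-searchable {n} L {R} R? = map′ to from (any? (λ r → Fin.any? λ f → Fin.any? λ l → spans? r f l) L)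
  where
  Spans : Rect → Fin n → Fin n → Set
  Spans r f l = Σ[ f≤l ∈ f Fin.≤ l ] size (interval f l f≤l) ≡ height r × R (r , interval f l f≤l)

  spans? : ∀ r f l → Dec (Spans r f l)
  spans? r f l with f Fin.≤? l
  ... | no  f≰l = no (f≰l ∘ proj₁)
  -- `first≤last` is irrelevant, so a test with this proof of `f ≤ l` is valid for any other.
  ... | yes f≤l = map′ (f≤l ,_) proj₂ ((size (interval f l f≤l) ≟ height r) ×-dec R? (r , interval f l f≤l))

  to : Any (λ r → ∃[ f ] ∃[ l ] Spans r f l) L → ∃ λ p → Assigned L p × R p
  to found = let r , r∈L , f , l , f≤l , size≡ , Rrι = find found in
             (r , interval f l f≤l) , (r∈L , size≡) , Rrι

  from : (∃ λ p → Assigned L p × R p) → Any (λ r → ∃[ f ] ∃[ l ] Spans r f l) L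
  from ((r , interval f l f≤l) , (r∈L , size≡) , Rrι) =
    lose r∈L (f , l , recompute (f Fin.≤? l) f≤l , size≡ , Rrι)

fills-searchable : ∀ {n} L m → Searchable (Fills {n} L m)
fills-searchable {n} L m R? = map′
  (λ (P , (_ , as) , widths , r) → P , fills as widths , r)
  (λ (P , F@(fills as widths) , r) → P , (fills-length F , as) , widths , r)
  (boundedLists-searchable (assigned-searchable L) (n * m)
    (λ P → Fin.all? (λ i → rowWidth i P ≟ m) ×-dec R? P))

-- Three nested finite searches: for a width below `m`, then for each of the two multisets.
splits? : ∀ {n} L m (P : List (Rect × Interval n)) → Dec (Splits L m P)
splits? L m P = map′
  (λ (_ , m₁<m , 0<m₁ , _ , F₁ , _ , F₂ , p) → splits 0<m₁ m₁<m F₁ F₂ p)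
  (λ (splits 0<m₁ m₁<m F₁ F₂ p) → _ , m₁<m , 0<m₁ , _ , F₁ , _ , F₂ , p)
  (anyUpTo? (λ m₁ → (0 <? m₁) ×-dec
    fills-searchable L m₁ (λ P₁ → fills-searchable L (m ∸ m₁) (λ P₂ →
      permutation? _≟ᴿ_ (shapes P₁ ++ shapes P₂) (shapes P)))) m)

-- Decided as the absence of a counterexample among the finitely many filling multisets.
allSplit? : ∀ n L → Decidable (AllSplit n L)
allSplit? n L m = map′
  (λ none P F → decidable-stable (splits? L m P) (λ ¬s → none (P , F , ¬s)))
  (λ all (P , F , ¬s) → ¬s (all P F))
  (¬? (fills-searchable {n} L m (λ P → ¬? (splits? L m P))))

-- Lower the bound while `Q` holds at its current value. At the first failure, any smaller bound
-- would demand `Q` there, so the descent has reached the least one.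
least-bound : {Q : ℕ → Set} → Decidable Q → ∀ B → (∀ m → m > B → Q m) →
              ∃[ b ] (∀ m → m > b → Q m) × (∀ c → (∀ m → m > c → Q m) → b ≤ c)
least-bound Q? zero    Q>B = zero , Q>B , λ _ _ → z≤n
least-bound {Q} Q? (suc B) Q>1+B with Q? (suc B)
... | no ¬q = suc B , Q>1+B , λ c Q>c → ≮⇒≥ (λ c<1+B → ¬q (Q>c (suc B) c<1+B))
... | yes q = least-bound Q? B Q>B
  where
  Q>B : ∀ m → m > B → Q m
  Q>B m m>B with m≤n⇒m<n∨m≡n m>B
  ... | inj₁ m>1+B = Q>1+B m m>1+B
  ... | inj₂ refl  = q

theorem3p6 : (n : ℕ) (L : List Rect) → Representable n L → StronglyNoetherian n L
theorem3p6 n L rep =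
  let b , split>b , minimal = least-bound (allSplit? n L) (cutBound n L) (wide⇒allSplit rep)
      equiv = subtilingBound⇔allSplit rep
  in b , Equivalence.from (equiv b) split>b , λ c → minimal c ∘ Equivalence.to (equiv c)
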